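{- Let $G(V,E)$ be a graph. If there exists an independent set of vertices $I\subset V$ such that $\sum_{v\in I} d(v)=\frac{|E|}{2}$, where $d(v)$ is the degree of $v$ in $G$, then $G$ is balanceable.
   Context: All graphs are simple and finite. A 2-coloring of the edges of $K_n$ is a function $\alpha:E(K_n)\to\{R,B\}$. It contains a balanced copy of a graph $G$ if $K_n$ has a (not necessarily induced) subgraph isomorphic to $G$ whose edge set is partitioned into $E_1,E_2$ with $\alpha(e)=R$ for $e\in E_1$, $\alpha(e)=B$ for $e\in E_2$, and $\big||E_1|-|E_2|\big|\le 1$. A graph $G$ is balanceable if there is an $n_0$ such that for every $n\ge n_0$ there exists an integer $m$ with $0\le m<\lfloor \frac12\binom n2\rfloor$ such that every 2-coloring $\alpha$ of $E(K_n)$ with $|\alpha^{ -1}(R)|>m$ and $|\alpha^{ -1}(B)|>m$ contains a balanced copy of $G$. -}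

module Defs where

open import Data.Fin using (Fin; _<?_; _≟_)
open import Data.Fin.Subset using (Subset; _∈_)
open import Data.Fin.Subset.Properties using (_∈?_)
open import Data.List using (List; _++_; allFin; cartesianProduct; filter; length; map; sum)
open import Data.List.Relation.Binary.Permutation.Propositional using (_↭_)
open import Data.List.Relation.Unary.All using (All)
open import Data.Nat using (ℕ; _<_; _≤_; _≥_; _/_; ∣_-_∣)
open import Data.Nat.Combinatorics using (_C_)
open import Data.Product using (Σ-syntax; ∃-syntax; _×_; _,_)
open import Function.Bundles using (_⇔_)
open import Function.Definitions using (Injective)
open import Level using (0ℓ)
open import Relation.Binary.Core using (Rel)
open import Relation.Binary.Definitions using (Decidable; DecidableEquality; Irreflexive; Symmetric)
open import Relation.Binary.PropositionalEquality using (_≡_; _≢_; refl; ≢-sym)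
open import Relation.Nullary using (yes; no; ¬_; ¬?; _×-dec_)

record Graph (n : ℕ) : Set₁ where
  infix 4 _∼_ _∼?_
  field
    _∼_         : Rel (Fin n) 0ℓ
    _∼?_        : Decidable _∼_
    symmetric   : Symmetric _∼_
    irreflexive : Irreflexive _≡_ _∼_

-- An unordered pair {i, j} is listed exactly once, as (i , j) with i < j.
edges : ∀ {n} → Graph n → List (Fin n × Fin n)
edges {n} G = filter (λ (i , j) → (i <? j) ×-dec (i ∼? j)) (cartesianProduct (allFin n) (allFin n))
  where open Graph G

degree : ∀ {n} → Graph n → Fin n → ℕ
degree {n} G v = length (filter (v ∼?_) (allFin n))
  where open Graph G

degreeSum : ∀ {n} → Graph n → Subset n → ℕ
degreeSum {n} G I = sum (map (degree G) (filter (_∈? I) (allFin n)))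

Independent : ∀ {n} → Graph n → Subset n → Set
Independent G I = ∀ {u v} → u ∈ I → v ∈ I → ¬ (u ∼ v)
  where open Graph G

K : ∀ n → Graph n
K n = record
  { _∼_         = _≢_
  ; _∼?_        = λ i j → ¬? (i ≟ j)
  ; symmetric   = ≢-sym
  ; irreflexive = λ i≡j i≢j → i≢j i≡j
  }

-- `graph` lives on all of Fin n, but only the elements of `vertices` are
-- vertices of the subgraph.
record Subgraph {n} (G : Graph n) : Set₁ where
  field
    vertices : Subset n
    graph    : Graph n
  open Graph graph public
  field
    endpoint : ∀ {i j} → i ∼ j → i ∈ vertices
    included : ∀ {i j} → i ∼ j → Graph._∼_ G i j

record _≅_ {k n} {G : Graph n} (H : Subgraph G) (F : Graph k) : Set where
  field
    φ         : Fin k → Fin n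
    injective : Injective _≡_ _≡_ φ
    image     : ∀ w → w ∈ Subgraph.vertices H ⇔ (∃[ u ] φ u ≡ w)
    adjacency : ∀ u v → Graph._∼_ F u v ⇔ Subgraph._∼_ H (φ u) (φ v)

data Colour : Set where
  R B : Colour

_≟ᶜ_ : DecidableEquality Colour
R ≟ᶜ R = yes refl
R ≟ᶜ B = no λ ()
B ≟ᶜ R = no λ ()
B ≟ᶜ B = yes refl

-- The values on the diagonal are never used.
record Colouring (n : ℕ) : Set where
  field
    colour    : Fin n → Fin n → Colour
    symmetric : ∀ i j → colour i j ≡ colour j i

HasColour : ∀ {n} → Colouring n → Colour → Fin n × Fin n → Set
HasColour α c (i , j) = Colouring.colour α i j ≡ c

-- The cardinality of α⁻¹(c).
classSize : ∀ {n} → Colouring n → Colour → ℕ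
classSize {n} α c = length (filter (λ (i , j) → Colouring.colour α i j ≟ᶜ c) (edges (K n)))

ContainsBalancedCopy : ∀ {k n} → Colouring n → Graph k → Set₁
ContainsBalancedCopy {n = n} α G =
  Σ[ H ∈ Subgraph (K n) ] H ≅ G ×
  (∃[ E₁ ] ∃[ E₂ ]
    edges (Subgraph.graph H) ↭ E₁ ++ E₂ ×
    All (HasColour α R) E₁ ×
    All (HasColour α B) E₂ ×
    ∣ length E₁ - length E₂ ∣ ≤ 1)

Balanceable : ∀ {k} → Graph k → Set₁
Balanceable G =
  ∃[ n₀ ] ∀ n → n ≥ n₀ →
    ∃[ m ] m < (n C 2) / 2 ×
      (∀ (α : Colouring n) → m < classSize α R → m < classSize α B → ContainsBalancedCopy α G)

{-# OPTIONS --safe #-}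

-- Taking m = ⌊C(n,2)/2⌋ - 1, both colour classes contain about n²/4 edges.  In
-- such a colouring we find a clique X of one colour that is joined to a set Y
-- entirely in the other colour, with |X| and |Y| large: then embedding I into Y
-- and the other vertices of G into X gives the edges at I one colour and the
-- remaining edges the other.  To find X and Y, the Kővári–Sós–Turán argument gives,
-- for each colour c, a large biclique A, B of colour c.  If A contains a large
-- clique of the opposite colour, we are done; otherwise Ramsey's theorem gives a
-- large clique of colour c.  In the remaining case there are a red clique and a
-- disjoint blue clique, and the bipartite Ramsey theorem between the two
-- finishes the proof.

module Submission where

open import Data.Empty using (⊥; ⊥-elim)
open import Data.Fin using (Fin; zero; suc; inject≤; _≟_) renaming (_<_ to _<ᶠ_)
open import Data.Fin.Properties using (any?; <-cmp; <-asym; inject≤-injective)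
open import Data.Fin.Subset using (Subset)
open import Data.Fin.Subset using () renaming (_∈_ to _∈ˢ_; _∉_ to _∉ˢ_)
open import Data.Fin.Subset.Properties using (_∈?_)
open import Data.List using (length)
open import Data.List using (List; []; _∷_; _++_; allFin; cartesianProduct; drop; filter; lookup; map; take)
import Data.List.Membership.DecPropositional as DecMembership
open import Data.List.Membership.Propositional using (_∈_; _∉_)
open import Data.List.Membership.Propositional.Properties using (∈-++⁺ˡ; ∈-++⁺ʳ; ∈-++⁻; ∈-∃++; ∈-allFin; ∈-cartesianProduct⁺; ∈-cartesianProduct⁻; ∈-filter⁺; ∈-filter⁻; ∈-lookup)
open import Data.List.Properties using (filter-++; filter-accept; filter-reject; filter-≐; length-++; length-++-sucʳ; length-drop; length-filter; length-tabulate; length-take; take++drop≡id)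
open import Data.List.Relation.Binary.Permutation.Propositional using (_↭_; prep; ↭-refl; ↭-sym; ↭-trans)
open import Data.List.Relation.Binary.Permutation.Propositional.Properties using (shift; ↭-length)
import Data.List.Relation.Binary.Sublist.Propositional as Sublist
open import Data.List.Relation.Binary.Sublist.Propositional using (_⊆_; []; _∷_; _∷ʳ_; ⊆-refl; ⊆-trans; minimum)
open import Data.List.Relation.Binary.Sublist.Propositional.Properties using (All-resp-⊆; drop-⊆; filter-⊆; take-⊆)
open import Data.List.Relation.Unary.All as All using ()
open import Data.List.Relation.Unary.All.Properties using (all-filter)
open import Data.List.Relation.Unary.AllPairs as AllPairs using (AllPairs; []; _∷_)
open import Data.List.Relation.Unary.Any using (here; there)
open import Data.List.Relation.Unary.Unique.Propositional using (Unique)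
import Data.List.Relation.Unary.Unique.Propositional.Properties as Unique
open import Data.Nat using (ℕ; _*_)
open import Data.Nat using (zero; suc; pred; _+_; _^_; _/_; _%_; _≤_; _<_; _≤?_; z≤n; s≤s; s≤s⁻¹; >-nonZero; NonZero; ∣_-_∣)
open import Data.Nat.Combinatorics using (_C_; nC1≡n; nCk+nC[k+1]≡[n+1]C[k+1])
open import Data.Nat.DivMod using (/-monoˡ-≤; m/n*n≤m; m%n<n; m≡m%n+[m/n]*n)
open import Data.Nat.ListAction using (sum)
open import Data.Nat.Properties hiding (_≟_; <-asym; <-cmp)
open import Data.Nat.Tactic.RingSolver using (solve-∀)
open import Data.Product using (∃-syntax; _×_)
open import Data.Product as Product using (_,_; proj₁; proj₂)
open import Data.Sum as Sum using (_⊎_; inj₁; inj₂)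
open import Data.Vec using (tabulate)
open import Data.Vec.Properties using (lookup∘tabulate; lookup⇒[]=; []=⇒lookup)
open import Function using (Injective; _∘_; mk⇔)
open import Level using (0ℓ)
open import Relation.Binary.Core using (REL; Rel)
open import Relation.Binary.Definitions using (Decidable; Symmetric; tri<; tri≈; tri>)
open import Relation.Binary.PropositionalEquality using (_≡_)
open import Relation.Binary.PropositionalEquality using (_≢_; refl; sym; trans; cong; cong₂; subst; subst₂; ≢-sym; module ≡-Reasoning)
open import Relation.Nullary using (¬_; ¬?; contradiction; does; no; yes; _×-dec_)
open import Relation.Nullary.Decidable using (dec-true)
open import Relation.Unary as U using (Pred)
open import Relation.Unary.Properties using (∁?)
open import Defs

-- Counting by filtering and matching lists.

private variable
  V W : Set

module _ {P : Pred V 0ℓ} (P? : U.Decidable P) where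

  filter-∁-↭ : ∀ xs → xs ↭ filter P? xs ++ filter (∁? P?) xs
  filter-∁-↭ []       = ↭-refl
  filter-∁-↭ (x ∷ xs) with P? x
  ... | yes _ = prep x (filter-∁-↭ xs)
  ... | no  _ = ↭-trans (prep x (filter-∁-↭ xs)) (↭-sym (shift x _ _))

  length-filter-∁ : ∀ xs → length xs ≡ length (filter P? xs) + length (filter (∁? P?) xs)
  length-filter-∁ xs = trans (↭-length (filter-∁-↭ xs)) (length-++ (filter P? xs))

  -- If both alternatives fail, the two parts together hold at most `m + n - 2` elements. The spare
  -- unit in `suc (length xs)` lets `ramsey` set one vertex aside first.
  filter-pigeonhole : ∀ m n xs → m + n ≤ suc (length xs) →
                      m ≤ length (filter P? xs) ⊎ n ≤ length (filter (∁? P?) xs)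
  filter-pigeonhole m n xs m+n≤ with m ≤? length (filter P? xs) | n ≤? length (filter (∁? P?) xs)
  ... | yes m≤ | _      = inj₁ m≤
  ... | no  _  | yes n≤ = inj₂ n≤
  ... | no m≰  | no n≰  = contradiction m+n≤ (<⇒≱ (begin-strict
    suc (length xs)                                          ≡⟨ cong suc (length-filter-∁ xs) ⟩
    suc (length (filter P? xs)) + length (filter (∁? P?) xs) <⟨ +-mono-≤-< (≰⇒> m≰) (≰⇒> n≰) ⟩
    m + n                                                    ∎))
    where open ≤-Reasoning

  length-filter-map : ∀ (f : W → V) xs → length (filter P? (map f xs)) ≡ length (filter (P? ∘ f) xs)
  length-filter-map f []       = refl
  length-filter-map f (x ∷ xs) with P? (f x)
  ... | yes _ = cong suc (length-filter-map f xs)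
  ... | no  _ = length-filter-map f xs

length-take-≤ : ∀ n (xs : List V) → length (take n xs) ≤ n
length-take-≤ n xs = ≤-trans (≤-reflexive (length-take n xs)) (m⊓n≤m n (length xs))

AllPairs-resp-⊆ : ∀ {T : Rel V 0ℓ} {xs ys} → xs ⊆ ys → AllPairs T ys → AllPairs T xs
AllPairs-resp-⊆ []         []        = []
AllPairs-resp-⊆ (_ ∷ʳ τ)   (_ ∷ pys) = AllPairs-resp-⊆ τ pys
AllPairs-resp-⊆ (refl ∷ τ) (p ∷ pys) = All-resp-⊆ τ p ∷ AllPairs-resp-⊆ τ pys

AllPairs-lookup : ∀ {T : Rel V 0ℓ} → Symmetric T → ∀ {xs} → AllPairs T xs →
                  ∀ {i j} → i ≢ j → T (lookup xs i) (lookup xs j)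
AllPairs-lookup T-sym (p ∷ ps) {zero}  {zero}  i≢j = contradiction refl i≢j
AllPairs-lookup T-sym (p ∷ ps) {zero}  {suc j} i≢j = All.lookup p (∈-lookup j)
AllPairs-lookup T-sym (p ∷ ps) {suc i} {zero}  i≢j = T-sym (All.lookup p (∈-lookup i))
AllPairs-lookup T-sym (p ∷ ps) {suc i} {suc j} i≢j = AllPairs-lookup T-sym ps (i≢j ∘ cong suc)

-- Strike the partner of the first `x` from `ys`; by injectivity no later element can need it.
-- Matching by a relation instead of a function lets `length-≡-via` run the same argument in both
-- directions.
length-≤-via : (T : REL V W 0ℓ) → ∀ {xs ys} → Unique xs →
               (∀ {x} → x ∈ xs → ∃[ y ] y ∈ ys × T x y) →
               (∀ {x x′ y} → T x y → T x′ y → x ≡ x′) →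
               length xs ≤ length ys
length-≤-via T []             total inj = z≤n
length-≤-via T {x ∷ xs} (x∉xs ∷ xs!) total inj with total (here refl)
... | y , y∈ys , Txy with ∈-∃++ y∈ys
... | as , bs , refl = subst (suc (length xs) ≤_) (sym (length-++-sucʳ as y bs))
                             (s≤s (length-≤-via T xs! total′ inj))
  where
  total′ : ∀ {x′} → x′ ∈ xs → ∃[ y′ ] y′ ∈ as ++ bs × T x′ y′
  total′ x′∈xs with total (there x′∈xs)
  ... | y′ , y′∈ys , Tx′y′ with ∈-++⁻ as y′∈ys
  ... | inj₁ y′∈as         = y′ , ∈-++⁺ˡ y′∈as , Tx′y′
  ... | inj₂ (here refl)   = contradiction (inj Txy Tx′y′) (All.lookup x∉xs x′∈xs)
  ... | inj₂ (there y′∈bs) = y′ , ∈-++⁺ʳ as y′∈bs , Tx′y′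

length-≤-⊆ : {xs ys : List V} → Unique xs → (∀ {x} → x ∈ xs → x ∈ ys) → length xs ≤ length ys
length-≤-⊆ xs! xs⊆ys = length-≤-via _≡_ xs! (λ x∈xs → _ , xs⊆ys x∈xs , refl) (λ p q → trans p (sym q))

length-≡-via : (T : REL V W 0ℓ) → ∀ {xs ys} → Unique xs → Unique ys →
               (∀ {x} → x ∈ xs → ∃[ y ] y ∈ ys × T x y) →
               (∀ {y} → y ∈ ys → ∃[ x ] x ∈ xs × T x y) →
               (∀ {x x′ y} → T x y → T x′ y → x ≡ x′) →
               (∀ {x y y′} → T x y → T x y′ → y ≡ y′) →
               length xs ≡ length ys
length-≡-via T xs! ys! totalˡ totalʳ inj func =
  ≤-antisym (length-≤-via T xs! totalˡ inj) (length-≤-via (λ y x → T x y) ys! totalʳ func)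

-- Edges between two vertex lists.

module _ {Q : REL V W 0ℓ} (Q? : Decidable Q) where

  -- Iterated halving; this serves both as the pigeonhole over neighbourhoods in the
  -- Kővári–Sós–Turán argument and as the bipartite Ramsey theorem.
  homogenise : ∀ s bs as → 2 ^ length bs * s ≤ length as →
               ∃[ as′ ] as′ ⊆ as × s ≤ length as′ ×
                 (∀ {a a′ b} → a ∈ as′ → a′ ∈ as′ → b ∈ bs → Q a b → Q a′ b)
  homogenise s []       as s≤as = as , ⊆-refl , subst (_≤ length as) (*-identityˡ s) s≤as , λ _ _ ()
  homogenise s (b ∷ bs) as s≤as with filter-pigeonhole (λ a → Q? a b) _ _ as
                                         (≤-trans (≤-reflexive double) (m≤n⇒m≤1+n s≤as))
    where
    doubling : ∀ m s → m * s + m * s ≡ 2 * m * s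
    doubling = solve-∀
    double : 2 ^ length bs * s + 2 ^ length bs * s ≡ 2 ^ length (b ∷ bs) * s
    double = doubling (2 ^ length bs) s
  ... | inj₁ s≤ with homogenise s bs _ s≤
  ...   | as′ , as′⊆ , s≤as′ , hom = as′ , ⊆-trans as′⊆ (filter-⊆ _ as) , s≤as′ , λ
    { a∈ a′∈ (here refl) _ → All.lookup (all-filter (λ a → Q? a b) as) (Sublist.lookup as′⊆ a′∈)
    ; a∈ a′∈ (there b∈)    → hom a∈ a′∈ b∈ }
  homogenise s (b ∷ bs) as s≤as | inj₂ s≤ with homogenise s bs _ s≤
  ...   | as′ , as′⊆ , s≤as′ , hom = as′ , ⊆-trans as′⊆ (filter-⊆ _ as) , s≤as′ , λ
    { a∈ a′∈ (here refl) q → contradiction q (All.lookup (all-filter (∁? (λ a → Q? a b)) as) (Sublist.lookup as′⊆ a∈))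
    ; a∈ a′∈ (there b∈)    → hom a∈ a′∈ b∈ }

  deg : List W → V → ℕ
  deg ys x = length (filter (Q? x) ys)

  edgeCount : List V → List W → ℕ
  edgeCount xs ys = sum (map (deg ys) xs)

  rich : ℕ → List W → List V → List V
  rich t ys = filter (λ x → t ≤? deg ys x)

  length-filter-cartesianProduct : ∀ xs ys →
    length (filter (λ (x , y) → Q? x y) (cartesianProduct xs ys)) ≡ edgeCount xs ys
  length-filter-cartesianProduct []       ys = refl
  length-filter-cartesianProduct (x ∷ xs) ys = begin
    length (filter Q?′ (map (x ,_) ys ++ cartesianProduct xs ys))
      ≡⟨ cong length (filter-++ Q?′ (map (x ,_) ys) _) ⟩
    length (filter Q?′ (map (x ,_) ys) ++ filter Q?′ (cartesianProduct xs ys))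
      ≡⟨ length-++ (filter Q?′ (map (x ,_) ys)) ⟩
    length (filter Q?′ (map (x ,_) ys)) + length (filter Q?′ (cartesianProduct xs ys))
      ≡⟨ cong₂ _+_ (length-filter-map Q?′ (x ,_) ys) (length-filter-cartesianProduct xs ys) ⟩
    deg ys x + edgeCount xs ys ∎
    where
    open ≡-Reasoning
    Q?′ = λ (x , y) → Q? x y

  edgeCount-++ : ∀ xs ys zs → edgeCount xs (ys ++ zs) ≡ edgeCount xs ys + edgeCount xs zs
  edgeCount-++ []       ys zs = refl
  edgeCount-++ (x ∷ xs) ys zs = begin
    deg (ys ++ zs) x + edgeCount xs (ys ++ zs)                ≡⟨ cong₂ _+_ deg-++ (edgeCount-++ xs ys zs) ⟩
    deg ys x + deg zs x + (edgeCount xs ys + edgeCount xs zs) ≡⟨ +-interchange (deg ys x) _ _ _ ⟩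
    deg ys x + edgeCount xs ys + (deg zs x + edgeCount xs zs) ∎
    where
    open ≡-Reasoning
    +-interchange : ∀ a b c d → a + b + (c + d) ≡ a + c + (b + d)
    +-interchange = solve-∀
    deg-++ : deg (ys ++ zs) x ≡ deg ys x + deg zs x
    deg-++ = trans (cong length (filter-++ (Q? x) ys zs)) (length-++ (filter (Q? x) ys))

  -- A rich vertex contributes at most `length ys` and any other less than `t`; the bound charges
  -- `t` to every vertex.
  edgeCount-≤ : ∀ t xs ys → edgeCount xs ys ≤ length (rich t ys xs) * length ys + length xs * t
  edgeCount-≤ t []       ys = z≤n
  edgeCount-≤ t (x ∷ xs) ys with t ≤? deg ys x
  ... | yes t≤ = begin
    deg ys x + edgeCount xs ys                  ≤⟨ +-mono-≤ (length-filter (Q? x) ys) (edgeCount-≤ t xs ys) ⟩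
    length ys + (r * length ys + length xs * t) ≡⟨ +-assoc (length ys) _ _ ⟨
    length ys + r * length ys + length xs * t   ≤⟨ +-monoʳ-≤ (length ys + r * length ys) (m≤n+m _ t) ⟩
    length ys + r * length ys + (t + length xs * t)
      ≡⟨ cong (λ zs → length zs * length ys + (t + length xs * t)) (filter-accept (λ x → t ≤? deg ys x) t≤) ⟨
    length (rich t ys (x ∷ xs)) * length ys + (t + length xs * t)    ∎
    where
    open ≤-Reasoning
    r = length (rich t ys xs)
  ... | no t≰ = begin
    deg ys x + edgeCount xs ys          ≤⟨ +-mono-≤ (<⇒≤ (≰⇒> t≰)) (edgeCount-≤ t xs ys) ⟩
    t + (r * length ys + length xs * t) ≡⟨ swap t (r * length ys) _ ⟩
    r * length ys + (t + length xs * t)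
      ≡⟨ cong (λ zs → length zs * length ys + (t + length xs * t)) (filter-reject (λ x → t ≤? deg ys x) t≰) ⟨
    length (rich t ys (x ∷ xs)) * length ys + (t + length xs * t)    ∎
    where
    open ≤-Reasoning
    r = length (rich t ys xs)
    swap : ∀ a b c → a + (b + c) ≡ b + (a + c)
    swap = solve-∀

  -- Cut `ys` into `r` blocks of at most `b` entries. If no block has `m` rich vertices,
  -- `edgeCount-≤` bounds the contribution of each block, and the bounds add up.
  rich-block : ∀ b t m xs r ys → length ys ≤ r * b →
               (∃[ zs ] zs ⊆ ys × length zs ≤ b × m ≤ length (rich t zs xs)) ⊎
               edgeCount xs ys ≤ r * (m * b + length xs * t)
  -- No blocks means that `ys` is empty; threshold 0 makes both terms of `edgeCount-≤` vanish.
  rich-block b t m xs zero    [] _ =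
    inj₂ (≤-trans (edgeCount-≤ 0 xs []) (≤-reflexive (cong₂ _+_ (*-zeroʳ (length (rich 0 [] xs))) (*-zeroʳ (length xs)))))
  rich-block b t m xs (suc r) ys ys≤ with m ≤? length (rich t (take b ys) xs)
  ... | yes m≤ = inj₁ (take b ys , take-⊆ b ys , length-take-≤ b ys , m≤)
  ... | no m≰ with rich-block b t m xs r (drop b ys)
                   (subst (_≤ r * b) (sym (length-drop b ys)) (m≤n+o⇒m∸n≤o (length ys) b ys≤))
  ... | inj₁ (zs , zs⊆ , rest) = inj₁ (zs , ⊆-trans zs⊆ (drop-⊆ b ys) , rest)
  ... | inj₂ e≤ = inj₂ (begin
    edgeCount xs ys                       ≡⟨ cong (edgeCount xs) (take++drop≡id b ys) ⟨
    edgeCount xs (take b ys ++ drop b ys) ≡⟨ edgeCount-++ xs (take b ys) (drop b ys) ⟩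
    edgeCount xs (take b ys) + edgeCount xs (drop b ys)
      ≤⟨ +-mono-≤ (≤-trans (edgeCount-≤ t xs (take b ys))
                           (+-monoˡ-≤ _ (*-mono-≤ (<⇒≤ (≰⇒> m≰)) (length-take-≤ b ys)))) e≤ ⟩
    m * b + length xs * t + r * (m * b + length xs * t) ∎)
    where
    open ≤-Reasoning

-- Ramsey's theorem.

module _ {Q : Rel V 0ℓ} (Q? : Decidable Q) where

  -- The pivot `x` has enough neighbours to look for a smaller clique, or enough non-neighbours to
  -- look for a smaller independent set; either step halves `2 ^ (p + q)`. `AllPairs` relates an
  -- entry to later ones only, and a pivot precedes all vertices chosen after it.
  ramsey : ∀ p q xs → 2 ^ (p + q) ≤ length xs →
           (∃[ ys ] ys ⊆ xs × length ys ≡ p × AllPairs Q ys) ⊎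
           (∃[ ys ] ys ⊆ xs × length ys ≡ q × AllPairs (λ x y → ¬ Q x y) ys)
  ramsey zero    q       xs       _    = inj₁ ([] , minimum xs , refl , [])
  ramsey (suc p) zero    xs       _    = inj₂ ([] , minimum xs , refl , [])
  ramsey (suc p) (suc q) []       2^≤  = contradiction 2^≤ (<⇒≱ (m^n>0 2 (suc p + suc q)))
  ramsey (suc p) (suc q) (x ∷ xs) 2^≤
    with filter-pigeonhole (Q? x) (2 ^ (p + suc q)) (2 ^ (suc p + q)) xs (≤-trans (≤-reflexive double) 2^≤)
    where
    double : 2 ^ (p + suc q) + 2 ^ (suc p + q) ≡ 2 ^ (suc p + suc q)
    double rewrite +-suc p q | +-identityʳ (2 ^ suc (p + q)) = refl
  ... | inj₁ 2^≤′ with ramsey p (suc q) _ 2^≤′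
  ...   | inj₁ (ys , ys⊆ , len , pairs) =
            inj₁ (x ∷ ys , refl ∷ ⊆-trans ys⊆ (filter-⊆ (Q? x) xs) , cong suc len ,
                  All-resp-⊆ ys⊆ (all-filter (Q? x) xs) ∷ pairs)
  ...   | inj₂ (ys , ys⊆ , rest) = inj₂ (ys , x ∷ʳ ⊆-trans ys⊆ (filter-⊆ (Q? x) xs) , rest)
  ramsey (suc p) (suc q) (x ∷ xs) 2^≤ | inj₂ 2^≤′ with ramsey (suc p) q _ 2^≤′
  ...   | inj₁ (ys , ys⊆ , rest) = inj₁ (ys , x ∷ʳ ⊆-trans ys⊆ (filter-⊆ (∁? (Q? x)) xs) , rest)
  ...   | inj₂ (ys , ys⊆ , len , pairs) =
            inj₂ (x ∷ ys , refl ∷ ⊆-trans ys⊆ (filter-⊆ (∁? (Q? x)) xs) , cong suc len ,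
                  All-resp-⊆ ys⊆ (all-filter (∁? (Q? x)) xs) ∷ pairs)

-- Large bicliques in dense relations.

-- Cut the n vertices into r blocks of 8t vertices.  If each block has at most m
-- vertices with t or more neighbours in it, then there are e ≲ n²/8 ordered pairs
-- of neighbours, whereas a colour class has about n²/4 edges.
block-bound : ∀ t m n r e → 0 < t → r * (8 * t) ≤ n + 8 * t → e ≤ r * (m * (8 * t) + n * t) →
              8 * e ≤ (n + 8 * t) * (n + 8 * m)
block-bound t m n r e 0<t r≤ e≤ = *-cancelʳ-≤ _ _ t {{>-nonZero 0<t}} (begin
  8 * e * t                           ≡⟨ comm e t ⟩
  8 * t * e                           ≤⟨ *-monoʳ-≤ (8 * t) e≤ ⟩
  8 * t * (r * (m * (8 * t) + n * t)) ≡⟨ assoc t r m n ⟩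
  r * (8 * t) * ((n + 8 * m) * t)     ≤⟨ *-monoˡ-≤ _ r≤ ⟩
  (n + 8 * t) * ((n + 8 * m) * t)     ≡⟨ *-assoc (n + 8 * t) _ t ⟨
  (n + 8 * t) * (n + 8 * m) * t       ∎)
  where
  open ≤-Reasoning
  comm : ∀ e t → 8 * e * t ≡ 8 * t * e
  comm = solve-∀
  assoc : ∀ t r m n → 8 * t * (r * (m * (8 * t) + n * t)) ≡ r * (8 * t) * ((n + 8 * m) * t)
  assoc = solve-∀

-- In `(n + 8 * t) * (n + 8 * m) + 2 * n + 4 - n * n` the coefficient of `n` is the first bracket.
-- The second bracket exceeds the constant term by one, which makes the inequality in
-- `block-contradiction` strict.
threshold : ℕ → ℕ → ℕ
threshold t m = (8 * t + 8 * m + 2) + (64 * (t * m) + 5)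

block-contradiction : ∀ t m n e → threshold t m ≤ n → n * n ≤ 4 * e + n + 2 →
                      8 * e ≤ (n + 8 * t) * (n + 8 * m) → ⊥
block-contradiction t m n e N≤n dense 8e≤ = <-irrefl refl (begin-strict
  n * n                      ≤⟨ n²≤ ⟩
  n * p + (64 * (t * m) + 4) <⟨ +-monoʳ-< (n * p) (+-monoʳ-< (64 * (t * m)) (n<1+n 4)) ⟩
  n * p + q                  ≤⟨ +-monoʳ-≤ (n * p) (m≤n*m q n {{>-nonZero (<-≤-trans 0<N N≤n)}}) ⟩
  n * p + n * q              ≡⟨ *-distribˡ-+ n p q ⟨
  n * (p + q)                ≤⟨ *-monoʳ-≤ n N≤n ⟩
  n * n                      ∎)
  where
  open ≤-Reasoning
  p = 8 * t + 8 * m + 2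
  q = 64 * (t * m) + 5
  0<N : 0 < p + q
  0<N = m≤n⇒m≤o+n p (m≤n⇒m≤o+n (64 * (t * m)) (s≤s z≤n))
  expand : ∀ n t m → (n + 8 * t) * (n + 8 * m) + 2 * n + 4 ≡ n * n + (n * (8 * t + 8 * m + 2) + (64 * (t * m) + 4))
  expand = solve-∀
  n²≤ : n * n ≤ n * p + (64 * (t * m) + 4)
  n²≤ = +-cancelˡ-≤ (n * n) _ _ (begin
    n * n + n * n                         ≤⟨ +-mono-≤ dense dense ⟩
    (4 * e + n + 2) + (4 * e + n + 2)     ≡⟨ regroup e n ⟩
    8 * e + 2 * n + 4                     ≤⟨ +-monoˡ-≤ 4 (+-monoˡ-≤ (2 * n) 8e≤) ⟩
    (n + 8 * t) * (n + 8 * m) + 2 * n + 4 ≡⟨ expand n t m ⟩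
    n * n + (n * p + (64 * (t * m) + 4))  ∎)
    where
    regroup : ∀ e n → (4 * e + n + 2) + (4 * e + n + 2) ≡ 8 * e + 2 * n + 4
    regroup = solve-∀

block-count : ∀ n b .{{_ : NonZero b}} → ∃[ r ] n ≤ r * b × r * b ≤ n + b
block-count n b = suc (n / b) ,
  ≤-trans (≤-reflexive (m≡m%n+[m/n]*n n b)) (+-monoˡ-≤ (n / b * b) (<⇒≤ (m%n<n n b))) ,
  ≤-trans (≤-reflexive (+-comm b (n / b * b))) (+-monoˡ-≤ b (m/n*n≤m n b))

module _ {Q : Rel V 0ℓ} (Q? : Decidable Q) where

  -- Density excludes the case in which every block has few rich vertices. A block of `8 * suc t`
  -- vertices admits at most `2 ^ (8 * suc t)` neighbourhoods, so among `suc s` times as many rich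
  -- vertices some `suc s` share one.
  biclique : ∀ t s xs → threshold (suc t) (2 ^ (8 * suc t) * suc s) ≤ length xs →
             length xs * length xs ≤ 4 * edgeCount Q? xs xs + length xs + 2 →
             ∃[ as ] ∃[ bs ] as ⊆ xs × bs ⊆ xs × suc s ≤ length as × suc t ≤ length bs ×
               (∀ {a b} → a ∈ as → b ∈ bs → Q a b)
  biclique t s xs N≤ dense with block-count (length xs) (8 * suc t)
  ... | r , n≤ , ≤n with rich-block Q? (8 * suc t) (suc t) (2 ^ (8 * suc t) * suc s) xs r xs n≤
  ... | inj₂ e≤ = ⊥-elim (block-contradiction (suc t) m (length xs) (edgeCount Q? xs xs) N≤ dense
                    (block-bound (suc t) m (length xs) r (edgeCount Q? xs xs) (s≤s z≤n) ≤n e≤))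
    where m = 2 ^ (8 * suc t) * suc s
  ... | inj₁ (zs , zs⊆ , zs≤ , m≤) with homogenise Q? (suc s) zs (rich Q? (suc t) zs xs)
                                        (≤-trans (*-monoˡ-≤ (suc s) (^-monoʳ-≤ 2 zs≤)) m≤)
  -- The bound `suc s` makes the list nonempty, and the neighbours of its head in the block serve as
  -- the other side.
  ... | as@(a ∷ _) , as⊆ , s≤as , hom =
    as , filter (Q? a) zs , ⊆-trans as⊆ (filter-⊆ _ xs) , ⊆-trans (filter-⊆ (Q? a) zs) zs⊆ , s≤as ,
    All.lookup (all-filter (λ x → suc t ≤? deg Q? zs x) xs) (Sublist.lookup as⊆ (here refl)) ,
    λ a′∈ b∈ → let (b∈zs , Qab) = ∈-filter⁻ (Q? a) b∈ in hom (here refl) a′∈ b∈zs Qab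

-- Edges as unordered pairs.

module _ {n} (G : Graph n) where
  open Graph G

  ∈-edges⁺ : ∀ {i j} → i <ᶠ j → i ∼ j → (i , j) ∈ edges G
  ∈-edges⁺ i<j i∼j = ∈-filter⁺ _ (∈-cartesianProduct⁺ (∈-allFin _) (∈-allFin _)) (i<j , i∼j)

  ∈-edges⁻ : ∀ {i j} → (i , j) ∈ edges G → i <ᶠ j × i ∼ j
  ∈-edges⁻ ij∈ = proj₂ (∈-filter⁻ _ {xs = cartesianProduct (allFin n) (allFin n)} ij∈)

  edges! : Unique (edges G)
  edges! = Unique.filter⁺ _ (Unique.cartesianProduct⁺ (Unique.allFin⁺ n) (Unique.allFin⁺ n))

-- Equality of unordered pairs. Edge lists store increasing pairs, but an injection of vertices may
-- reverse the order, so images are compared up to a swap.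
_≈_ : {V : Set} → V × V → V × V → Set
(a , b) ≈ (c , d) = (a ≡ c × b ≡ d) ⊎ (a ≡ d × b ≡ c)

≈-sym : ∀ {V : Set} {p q : V × V} → p ≈ q → q ≈ p
≈-sym (inj₁ (refl , refl)) = inj₁ (refl , refl)
≈-sym (inj₂ (refl , refl)) = inj₂ (refl , refl)

≈-trans : ∀ {V : Set} {p q r : V × V} → p ≈ q → q ≈ r → p ≈ r
≈-trans (inj₁ (refl , refl)) q≈r                  = q≈r
≈-trans (inj₂ (refl , refl)) (inj₁ (refl , refl)) = inj₂ (refl , refl)
≈-trans (inj₂ (refl , refl)) (inj₂ (refl , refl)) = inj₁ (refl , refl)

≈-map⁻ : ∀ {V W : Set} {f : V → W} → Injective _≡_ _≡_ f → ∀ {p q} → Product.map f f p ≈ Product.map f f q → p ≈ q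
≈-map⁻ f-inj (inj₁ (p , q)) = inj₁ (f-inj p , f-inj q)
≈-map⁻ f-inj (inj₂ (p , q)) = inj₂ (f-inj p , f-inj q)

≈⇒≡ : ∀ {n} {i j i′ j′ : Fin n} → i <ᶠ j → i′ <ᶠ j′ → (i , j) ≈ (i′ , j′) → (i , j) ≡ (i′ , j′)
≈⇒≡ i<j i′<j′ (inj₁ (refl , refl)) = refl
≈⇒≡ i<j i′<j′ (inj₂ (refl , refl)) = contradiction i′<j′ (<-asym i<j)

sorted : ∀ {n} {i j : Fin n} → i ≢ j → ∃[ i′ ] ∃[ j′ ] i′ <ᶠ j′ × (i , j) ≈ (i′ , j′)
sorted {i = i} {j} i≢j with <-cmp i j
... | tri< i<j _ _ = i , j , i<j , inj₁ (refl , refl)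
... | tri≈ _ i≡j _ = contradiction i≡j i≢j
... | tri> _ _ j<i = j , i , j<i , inj₂ (refl , refl)

≈-resp : ∀ {n} (G : Graph n) (let open Graph G) {i j i′ j′} → (i , j) ≈ (i′ , j′) → i ∼ j → i′ ∼ j′
≈-resp G (inj₁ (refl , refl)) i∼j = i∼j
≈-resp G (inj₂ (refl , refl)) i∼j = Graph.symmetric G i∼j

-- The copy of a graph under an injection.

module _ {k n} (G : Graph k) {φ : Fin k → Fin n} (φ-injective : Injective _≡_ _≡_ φ) where
  open Graph G

  image : Graph n
  image = record
    { _∼_         = λ i j → ∃[ u ] ∃[ v ] u ∼ v × φ u ≡ i × φ v ≡ j
    ; _∼?_        = λ i j → any? λ u → any? λ v → (u ∼? v) ×-dec (φ u ≟ i) ×-dec (φ v ≟ j)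
    ; symmetric   = λ (u , v , u∼v , φu , φv) → v , u , symmetric u∼v , φv , φu
    ; irreflexive = λ i≡j (u , v , u∼v , φu , φv) →
        irreflexive (φ-injective (trans φu (trans i≡j (sym φv)))) u∼v
    }

  range : Subset n
  range = tabulate λ w → does (any? λ u → φ u ≟ w)

  ∈-range⁺ : ∀ {w} → (∃[ u ] φ u ≡ w) → w ∈ˢ range
  ∈-range⁺ {w} u = lookup⇒[]= w range (trans (lookup∘tabulate _ w) (dec-true (any? λ u → φ u ≟ w) u))

  ∈-range⁻ : ∀ {w} → w ∈ˢ range → ∃[ u ] φ u ≡ w
  ∈-range⁻ {w} w∈
    with any? (λ u → φ u ≟ w)
       | trans (sym (lookup∘tabulate (λ w → does (any? λ u → φ u ≟ w)) w)) ([]=⇒lookup w∈)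
  ... | yes u | _ = u
  ... | no  _ | ()

  copy : Subgraph (K n)
  copy = record
    { vertices = range
    ; graph    = image
    ; endpoint = λ (u , _ , _ , φu , _) → ∈-range⁺ (u , φu)
    ; included = λ i∼j i≡j → Graph.irreflexive image i≡j i∼j
    }

  copy≅ : copy ≅ G
  copy≅ = record
    { φ         = φ
    ; injective = φ-injective
    ; image     = λ _ → mk⇔ ∈-range⁻ ∈-range⁺
    ; adjacency = λ u v → mk⇔ (λ u∼v → u , v , u∼v , refl , refl)
                              (λ (_ , _ , u∼v , φu , φv) → subst₂ _∼_ (φ-injective φu) (φ-injective φv) u∼v)
    }

  module _ {P : Pred (Fin n × Fin n) 0ℓ} (P? : U.Decidable P) (P-resp : ∀ {p q} → p ≈ q → P p → P q) where

    -- An edge and its image may be listed in opposite orders, so the two lists are matched through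
    -- `≈`; `P-resp` carries the property across the swap.
    length-filter-edges-image : length (filter P? (edges image)) ≡ length (filter (P? ∘ Product.map φ φ) (edges G))
    length-filter-edges-image =
      length-≡-via _⟶_ (Unique.filter⁺ P? (edges! image)) (Unique.filter⁺ (P? ∘ Product.map φ φ) (edges! G))
        totalˡ totalʳ
        (λ (i<j , _ , p≈) (i′<j′ , _ , p′≈) → ≈⇒≡ i<j i′<j′ (≈-trans p≈ (≈-sym p′≈)))
        (λ (_ , u<v , ≈q) (_ , u′<v′ , ≈q′) → ≈⇒≡ u<v u′<v′ (≈-map⁻ φ-injective (≈-trans (≈-sym ≈q) ≈q′)))
      where
      _⟶_ : Fin n × Fin n → Fin k × Fin k → Set
      (i , j) ⟶ (u , v) = i <ᶠ j × u <ᶠ v × (i , j) ≈ (φ u , φ v)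

      totalˡ : ∀ {p} → p ∈ filter P? (edges image) → ∃[ q ] q ∈ filter (P? ∘ Product.map φ φ) (edges G) × p ⟶ q
      totalˡ p∈ with ∈-filter⁻ P? p∈
      ... | p∈ , Pp with ∈-edges⁻ image p∈
      ... | i<j , u , v , u∼v , refl , refl with sorted (λ u≡v → irreflexive u≡v u∼v)
      ... | u′ , v′ , u′<v′ , uv≈ =
        _ , ∈-filter⁺ (P? ∘ Product.map φ φ) (∈-edges⁺ G u′<v′ (≈-resp G uv≈ u∼v)) (P-resp φuv≈ Pp) , i<j , u′<v′ , φuv≈
        where
        φuv≈ : (φ u , φ v) ≈ (φ u′ , φ v′)
        φuv≈ = Sum.map (Product.map (cong φ) (cong φ)) (Product.map (cong φ) (cong φ)) uv≈

      totalʳ : ∀ {q} → q ∈ filter (P? ∘ Product.map φ φ) (edges G) → ∃[ p ] p ∈ filter P? (edges image) × p ⟶ q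
      totalʳ {u , v} q∈ with ∈-filter⁻ (P? ∘ Product.map φ φ) {xs = edges G} q∈
      ... | q∈ , Pq with ∈-edges⁻ G q∈
      ... | u<v , u∼v with sorted (λ φu≡φv → irreflexive (φ-injective φu≡φv) u∼v)
      ... | i , j , i<j , φuv≈ =
        _ , ∈-filter⁺ P? (∈-edges⁺ image i<j (≈-resp image φuv≈ (u , v , u∼v , refl , refl))) (P-resp φuv≈ Pq) ,
        i<j , u<v , ≈-sym φuv≈

-- Edges meeting an independent set.

module _ {k} (G : Graph k) {I : Subset k} (independent : Independent G I) where
  open Graph G

  -- By independence an edge meeting `I` has exactly one end there. Orienting it away from that end
  -- matches these edges with the darts leaving `I`, which the degrees count.
  length-filter-touching : ∀ {P : Pred (Fin k × Fin k) 0ℓ} (P? : U.Decidable P) →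
    (∀ {u v} → u ∼ v → P (u , v) → u ∈ˢ I ⊎ v ∈ˢ I) →
    (∀ {u v} → u ∼ v → u ∈ˢ I ⊎ v ∈ˢ I → P (u , v)) →
    length (filter P? (edges G)) ≡ degreeSum G I
  length-filter-touching {P} P? P⇒ ⇒P =
    trans (length-≡-via _⟶_ (Unique.filter⁺ P? (edges! G)) darts! totalˡ totalʳ
             (λ (u<v , _ , p≈) (u′<v′ , _ , p′≈) → ≈⇒≡ u<v u′<v′ (≈-trans p≈ (≈-sym p′≈)))
             (λ (_ , d , ≈q) (_ , d′ , ≈q′) → dart-≡ d d′ (≈-trans (≈-sym ≈q) ≈q′)))
          -- `degreeSum G I` unfolds to the `edgeCount` from `I` to all vertices.
          (length-filter-cartesianProduct _∼?_ (filter (_∈? I) (allFin k)) (allFin k))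
    where
    Dart : Fin k × Fin k → Set
    Dart (a , b) = a ∈ˢ I × a ∼ b

    darts : List (Fin k × Fin k)
    darts = filter (λ (a , b) → a ∼? b) (cartesianProduct (filter (_∈? I) (allFin k)) (allFin k))

    darts! : Unique darts
    darts! = Unique.filter⁺ _ (Unique.cartesianProduct⁺ (Unique.filter⁺ (_∈? I) (Unique.allFin⁺ k)) (Unique.allFin⁺ k))

    ∈-darts⁺ : ∀ {a b} → Dart (a , b) → (a , b) ∈ darts
    ∈-darts⁺ (a∈I , a∼b) = ∈-filter⁺ _ (∈-cartesianProduct⁺ (∈-filter⁺ (_∈? I) (∈-allFin _) a∈I) (∈-allFin _)) a∼b

    ∈-darts⁻ : ∀ {a b} → (a , b) ∈ darts → Dart (a , b)
    ∈-darts⁻ ab∈ with ∈-filter⁻ _ {xs = cartesianProduct (filter (_∈? I) (allFin k)) (allFin k)} ab∈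
    ... | ab∈ , a∼b = proj₂ (∈-filter⁻ (_∈? I) {xs = allFin k} (proj₁ (∈-cartesianProduct⁻ _ (allFin k) ab∈))) , a∼b

    dart-≡ : ∀ {p q} → Dart p → Dart q → p ≈ q → p ≡ q
    dart-≡ _         _         (inj₁ (refl , refl)) = refl
    -- A dart together with its reverse would put both ends of an edge in `I`.
    dart-≡ (a∈I , a∼b) (b∈I , _) (inj₂ (refl , refl)) = contradiction a∼b (independent a∈I b∈I)

    _⟶_ : Fin k × Fin k → Fin k × Fin k → Set
    (u , v) ⟶ q = u <ᶠ v × Dart q × (u , v) ≈ q

    totalˡ : ∀ {p} → p ∈ filter P? (edges G) → ∃[ q ] q ∈ darts × p ⟶ q
    totalˡ p∈ with ∈-filter⁻ P? {xs = edges G} p∈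
    ... | p∈ , Pp with ∈-edges⁻ G p∈
    ... | u<v , u∼v with P⇒ u∼v Pp
    ... | inj₁ u∈I = _ , ∈-darts⁺ (u∈I , u∼v) , u<v , (u∈I , u∼v) , inj₁ (refl , refl)
    ... | inj₂ v∈I = _ , ∈-darts⁺ (v∈I , symmetric u∼v) , u<v , (v∈I , symmetric u∼v) , inj₂ (refl , refl)

    totalʳ : ∀ {q} → q ∈ darts → ∃[ p ] p ∈ filter P? (edges G) × p ⟶ q
    totalʳ q∈ with ∈-darts⁻ q∈
    ... | a∈I , a∼b with sorted (λ a≡b → irreflexive a≡b a∼b)
    ... | u , v , u<v , inj₁ (refl , refl) =
      _ , ∈-filter⁺ P? (∈-edges⁺ G u<v a∼b) (⇒P a∼b (inj₁ a∈I)) , u<v , (a∈I , a∼b) , inj₁ (refl , refl)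
    ... | u , v , u<v , inj₂ (refl , refl) =
      _ , ∈-filter⁺ P? (∈-edges⁺ G u<v (symmetric a∼b)) (⇒P (symmetric a∼b) (inj₂ a∈I)) , u<v , (a∈I , a∼b) , inj₂ (refl , refl)

-- Colours and balanced copies.

opp : Colour → Colour
opp R = B
opp B = R

≢⇒≡opp : ∀ {c d} → d ≢ c → d ≡ opp c
≢⇒≡opp {R} {R} d≢c = contradiction refl d≢c
≢⇒≡opp {R} {B} d≢c = refl
≢⇒≡opp {B} {R} d≢c = refl
≢⇒≡opp {B} {B} d≢c = contradiction refl d≢c

opp-≢ : ∀ {c} → opp c ≢ c
opp-≢ {R} ()
opp-≢ {B} ()

module _ {k n} (G : Graph k) {I : Subset k} (independent : Independent G I)
         (half : 2 * degreeSum G I ≡ length (edges G))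
         (α : Colouring n) {φ : Fin k → Fin n} (φ-injective : Injective _≡_ _≡_ φ) where
  open Graph G
  open Colouring α using (colour)

  -- The edges meeting `I` number `D` by `length-filter-touching`, and `half` leaves `D` for the
  -- rest. Hence red and blue get equally many edges, whichever of them is `c`.
  balanced-copy : ∀ c →
    (∀ {u v} → u ∼ v → u ∈ˢ I ⊎ v ∈ˢ I → colour (φ u) (φ v) ≡ c) →
    (∀ {u v} → u ∼ v → u ∉ˢ I → v ∉ˢ I → colour (φ u) (φ v) ≡ opp c) →
    ContainsBalancedCopy α G
  balanced-copy c touching avoiding =
    copy G φ-injective , copy≅ G φ-injective ,
    filter (coloured R) E , filter (coloured B) E ,
    subst (λ zs → E ↭ filter (coloured R) E ++ zs)
      (filter-≐ (∁? (coloured R)) (coloured B) (≢⇒≡opp , λ p q → opp-≢ (trans (sym p) q)) E)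
      (filter-∁-↭ (coloured R) E) ,
    all-filter (coloured R) E , all-filter (coloured B) E ,
    subst (_≤ 1) (sym (trans (cong (λ l → ∣ l - length (filter (coloured B) E) ∣) (trans (size R) (sym (size B))))
                             (∣n-n∣≡0 (length (filter (coloured B) E))))) z≤n
    where
    E = edges (image G φ-injective)
    D = degreeSum G I

    coloured : ∀ d → U.Decidable (HasColour α d)
    coloured d (i , j) = colour i j ≟ᶜ d

    coloured-resp : ∀ {d p q} → p ≈ q → HasColour α d p → HasColour α d q
    coloured-resp (inj₁ (refl , refl)) ≡d = ≡d
    coloured-resp (inj₂ (refl , refl)) ≡d = trans (Colouring.symmetric α _ _) ≡d

    P? : ∀ d → U.Decidable (HasColour α d ∘ Product.map φ φ)
    P? d = coloured d ∘ Product.map φ φ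

    colour-c⇒touching : ∀ {u v} → u ∼ v → colour (φ u) (φ v) ≡ c → u ∈ˢ I ⊎ v ∈ˢ I
    colour-c⇒touching {u} {v} u∼v ≡c with u ∈? I | v ∈? I
    ... | yes u∈I | _       = inj₁ u∈I
    ... | no  _   | yes v∈I = inj₂ v∈I
    ... | no u∉I  | no v∉I  = contradiction (trans (sym (avoiding u∼v u∉I v∉I)) ≡c) opp-≢

    size-c : length (filter (P? c) (edges G)) ≡ D
    size-c = length-filter-touching G independent (P? c) colour-c⇒touching touching

    size-∁c : length (filter (∁? (P? c)) (edges G)) ≡ D
    size-∁c = +-cancelˡ-≡ D _ _ (begin
      D + length (filter (∁? (P? c)) (edges G))
        ≡⟨ cong (_+ length (filter (∁? (P? c)) (edges G))) size-c ⟨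
      length (filter (P? c) (edges G)) + length (filter (∁? (P? c)) (edges G))
        ≡⟨ length-filter-∁ (P? c) (edges G) ⟨
      length (edges G) ≡⟨ half ⟨
      2 * D            ≡⟨ cong (D +_) (+-identityʳ D) ⟩
      D + D            ∎)
      where open ≡-Reasoning

    size : ∀ d → length (filter (coloured d) E) ≡ D
    size d with d ≟ᶜ c
    ... | yes refl = trans (length-filter-edges-image G φ-injective (coloured d) coloured-resp) size-c
    ... | no d≢c = trans (length-filter-edges-image G φ-injective (coloured d) coloured-resp)
                     (trans (cong length (filter-≐ (P? d) (∁? (P? c))
                        ((λ p q → d≢c (trans (sym p) q)) , λ ≢c → trans (≢⇒≡opp ≢c) (sym (≢⇒≡opp d≢c)))
                        (edges G))) size-∁c)

-- Unavoidable two-coloured patterns.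

splitThreshold : ℕ → ℕ → ℕ → ℕ
-- One side of the biclique must keep `2 ^ (suc s + q)` vertices for Ramsey's theorem after losing
-- `z`; the other side needs only `suc s`.
splitThreshold s q z = threshold (suc s) (2 ^ (8 * suc s) * suc (2 ^ (suc s + q) + z))

-- Unless a split appears, the first summand yields a blue clique on `suc s + suc s` vertices, and
-- the second a red clique disjoint from it, of the size that `two-cliques⇒split` asks for. The sum
-- dominates both.
n₀ : ℕ → ℕ
n₀ s = splitThreshold s (suc s + suc s) 0 + splitThreshold s (2 ^ (suc s + suc s) * suc s) (suc s + suc s)

module _ {n} (α : Colouring n) where
  open Colouring α using (colour) renaming (symmetric to colour-sym)
  open DecMembership (_≟_ {n}) using () renaming (_∈?_ to _∈ˡ?_)

  -- `colour` takes arbitrary values on the diagonal, so distinctness is built in; it also keeps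
  -- cliques free of repetitions.
  Adj : Colour → Rel (Fin n) 0ℓ
  Adj c i j = i ≢ j × colour i j ≡ c

  Adj? : ∀ c → Decidable (Adj c)
  Adj? c i j = ¬? (i ≟ j) ×-dec (colour i j ≟ᶜ c)

  Adj-sym : ∀ {c} → Symmetric (Adj c)
  Adj-sym (i≢j , ≡c) = ≢-sym i≢j , trans (colour-sym _ _) ≡c

  Clique : Colour → List (Fin n) → Set
  Clique c = AllPairs (Adj c)

  -- The colours inside `Y` are left free because the independent set is placed there. `Y!` supplies
  -- the injectivity that the clique condition gives on `X`.
  record Split (c : Colour) (s : ℕ) : Set where
    field
      X Y      : List (Fin n)
      X-length : s ≤ length X
      Y-length : s ≤ length Y
      X-clique : Clique (opp c) X
      Y!       : Unique Y
      cross    : ∀ {x y} → x ∈ X → y ∈ Y → Adj c x y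

  -- Here `edgeCount` counts two ordered pairs for each edge. Keeping only the increasing one is
  -- enough, since `block-bound` leaves room for the factor two.
  classSize≤edgeCount : ∀ c → classSize α c ≤ edgeCount (Adj? c) (allFin n) (allFin n)
  classSize≤edgeCount c = subst (classSize α c ≤_) (length-filter-cartesianProduct (Adj? c) (allFin n) (allFin n))
    (length-≤-⊆ (Unique.filter⁺ _ (edges! (K n))) λ ij∈ →
      let (ij∈ , ≡c) = ∈-filter⁻ _ {xs = edges (K n)} ij∈ in
      ∈-filter⁺ (λ (i , j) → Adj? c i j) (∈-cartesianProduct⁺ (∈-allFin _) (∈-allFin _))
                                        (proj₂ (∈-edges⁻ (K n) ij∈) , ≡c))

  avoid : ∀ s xs zs → Unique xs → s + length zs ≤ length xs → s ≤ length (filter (∁? (_∈ˡ? zs)) xs)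
  avoid s xs zs xs! s≤ = +-cancelʳ-≤ (length zs) s _ (begin
    s + length zs ≤⟨ s≤ ⟩
    length xs     ≡⟨ length-filter-∁ (_∈ˡ? zs) xs ⟩
    length (filter (_∈ˡ? zs) xs) + length (filter (∁? (_∈ˡ? zs)) xs)
      ≤⟨ +-monoˡ-≤ _ (length-≤-⊆ (Unique.filter⁺ (_∈ˡ? zs) xs!) (λ x∈ → proj₂ (∈-filter⁻ (_∈ˡ? zs) {xs = xs} x∈))) ⟩
    length zs + length (filter (∁? (_∈ˡ? zs)) xs) ≡⟨ +-comm (length zs) _ ⟩
    length (filter (∁? (_∈ˡ? zs)) xs) + length zs ∎)
    where open ≤-Reasoning

  -- `Adj c` could also fail through equality; uniqueness of `xs` excludes this and leaves the
  -- opposite colour.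
  coloured-ramsey : ∀ c p q xs → Unique xs → 2 ^ (p + q) ≤ length xs →
                    (∃[ ys ] ys ⊆ xs × length ys ≡ p × Clique c ys) ⊎
                    (∃[ ys ] ys ⊆ xs × length ys ≡ q × Clique (opp c) ys)
  coloured-ramsey c p q xs xs! 2^≤ with ramsey (Adj? c) p q xs 2^≤
  ... | inj₁ clique = inj₁ clique
  ... | inj₂ (ys , ys⊆ , len , pairs) =
    inj₂ (ys , ys⊆ , len , AllPairs.zipWith (λ (i≢j , ¬adj) → i≢j , ≢⇒≡opp (¬adj ∘ (i≢j ,_)))
                                            (AllPairs-resp-⊆ ys⊆ xs! , pairs))

  -- Ramsey's theorem is applied inside one side of a biclique of colour `c`; a clique of the
  -- opposite colour forms a split with the other side. Removing `zs` first keeps the clique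
  -- disjoint from one found earlier.
  split-or-clique : ∀ c s q z zs → length zs ≡ z →
    splitThreshold s q z ≤ n →
    n * n ≤ 4 * classSize α c + n + 2 →
    Split c (suc s) ⊎ (∃[ ys ] length ys ≡ q × Clique c ys × (∀ {y} → y ∈ ys → y ∉ zs))
  split-or-clique c s q z zs refl N≤n dense
    with biclique (Adj? c) s (2 ^ (suc s + q) + z) (allFin n)
           (≤-trans N≤n (≤-reflexive (sym length-allFin)))
           (subst (λ l → l * l ≤ 4 * edgeCount (Adj? c) (allFin n) (allFin n) + l + 2) (sym length-allFin)
             (≤-trans dense (+-monoˡ-≤ 2 (+-monoˡ-≤ n (*-monoʳ-≤ 4 (classSize≤edgeCount c))))))
    where
    length-allFin : length (allFin n) ≡ n
    length-allFin = length-tabulate _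
  ... | as , bs , as⊆ , bs⊆ , s≤as , t≤bs , as∼bs
    with coloured-ramsey c q (suc s) (filter (∁? (_∈ˡ? zs)) as) (Unique.filter⁺ _ as!)
           (subst (λ m → 2 ^ m ≤ length (filter (∁? (_∈ˡ? zs)) as)) (+-comm (suc s) q) (avoid _ as zs as! (<⇒≤ s≤as)))
    where
    as! : Unique as
    as! = AllPairs-resp-⊆ as⊆ (Unique.allFin⁺ n)
  ... | inj₁ (ys , ys⊆ , len , clique) =
    inj₂ (ys , len , clique , λ y∈ → proj₂ (∈-filter⁻ (∁? (_∈ˡ? zs)) {xs = as} (Sublist.lookup ys⊆ y∈)))
  ... | inj₂ (ys , ys⊆ , len , clique) = inj₁ record
    { X        = ys
    ; Y        = bs
    ; X-length = ≤-reflexive (sym len)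
    ; Y-length = t≤bs
    ; X-clique = clique
    ; Y!       = AllPairs-resp-⊆ bs⊆ (Unique.allFin⁺ n)
    ; cross    = λ x∈ → as∼bs (Sublist.lookup (⊆-trans ys⊆ (filter-⊆ _ as)) x∈)
    }

  -- After thinning `P`, all survivors have the same red neighbours in `Q`. At least half of `Q` is
  -- then joined to them entirely in red or entirely in blue, and the clique of the opposite colour
  -- becomes `X`.
  two-cliques⇒split : ∀ s P Q → Clique R P → Clique B Q → (∀ {x} → x ∈ P → x ∉ Q) →
    length Q ≡ suc s + suc s → 2 ^ (suc s + suc s) * suc s ≤ length P → ∃[ c ] Split c (suc s)
  two-cliques⇒split s P Q P-clique Q-clique disjoint |Q| P≥
    with homogenise (Adj? R) (suc s) Q P (subst (λ m → 2 ^ m * suc s ≤ length P) (sym |Q|) P≥)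
  ... | P′@(p ∷ _) , P′⊆P , s≤P′ , hom
    with filter-pigeonhole (Adj? R p) (suc s) (suc s) Q (≤-trans (≤-reflexive (sym |Q|)) (n≤1+n _))
  ... | inj₁ s≤ = R , record
    { X        = filter (Adj? R p) Q
    ; Y        = P′
    ; X-length = s≤
    ; Y-length = s≤P′
    ; X-clique = AllPairs-resp-⊆ (filter-⊆ _ Q) Q-clique
    ; Y!       = AllPairs-resp-⊆ P′⊆P (AllPairs.map proj₁ P-clique)
    ; cross    = λ x∈ y∈ →
        let (x∈Q , adj) = ∈-filter⁻ (Adj? R p) {xs = Q} x∈
        in Adj-sym (hom (here refl) y∈ x∈Q adj)
    }
  ... | inj₂ s≤ = B , record
    { X        = P′
    ; Y        = filter (∁? (Adj? R p)) Q
    ; X-length = s≤P′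
    ; Y-length = s≤
    ; X-clique = AllPairs-resp-⊆ P′⊆P P-clique
    ; Y!       = Unique.filter⁺ _ (AllPairs.map proj₁ Q-clique)
    ; cross    = λ x∈ y∈ →
        let (y∈Q , ¬adj) = ∈-filter⁻ (∁? (Adj? R p)) {xs = Q} y∈
            -- Failing to be red-adjacent means blue only for distinct vertices; disjointness enters
            -- here.
            x≢y = λ { refl → disjoint (Sublist.lookup P′⊆P x∈) y∈Q }
        in x≢y , ≢⇒≡opp λ ≡R → ¬adj (hom x∈ (here refl) y∈Q (x≢y , ≡R))
    }

  unavoidable-split : ∀ s → n₀ s ≤ n → (∀ c → n * n ≤ 4 * classSize α c + n + 2) → ∃[ c ] Split c (suc s)
  unavoidable-split s n≥ dense =
    Sum.[ (B ,_) , (λ (Q , |Q| , Q-clique , _) →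
      Sum.[ (R ,_) , (λ (P , |P| , P-clique , disjoint) →
        two-cliques⇒split s P Q P-clique Q-clique disjoint |Q| (≤-reflexive (sym |P|)))
      ] (split-or-clique R s p (suc s + suc s) Q |Q|
             (≤-trans (m≤n+m _ (splitThreshold s (suc s + suc s) 0)) n≥) (dense R)))
    ] (split-or-clique B s (suc s + suc s) 0 [] refl
           (≤-trans (m≤m+n _ (splitThreshold s p (suc s + suc s))) n≥) (dense B))
    where
    p = 2 ^ (suc s + suc s) * suc s

  -- Embedding the graph into a split.

  module _ {k} (G : Graph k) {I : Subset k} (independent : Independent G I) {c} (split : Split c k) where
    open Graph G
    open Split split

    x y : Fin k → Fin n
    x u = lookup X (inject≤ u X-length)
    y u = lookup Y (inject≤ u Y-length)

    x-adj : ∀ {u v} → u ≢ v → Adj (opp c) (x u) (x v)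
    x-adj u≢v = AllPairs-lookup Adj-sym X-clique (u≢v ∘ inject≤-injective X-length X-length _ _)

    y-≢ : ∀ {u v} → u ≢ v → y u ≢ y v
    y-≢ u≢v = AllPairs-lookup ≢-sym Y! (u≢v ∘ inject≤-injective Y-length Y-length _ _)

    xy-adj : ∀ u v → Adj c (x u) (y v)
    xy-adj u v = cross (∈-lookup (inject≤ u X-length)) (∈-lookup (inject≤ v Y-length))

    φ : Fin k → Fin n
    φ u with u ∈? I
    ... | yes _ = y u
    ... | no  _ = x u

    φ-injective : Injective _≡_ _≡_ φ
    φ-injective {u} {v} φu≡φv with u ≟ v
    ... | yes u≡v = u≡v
    ... | no u≢v with u ∈? I | v ∈? I
    ...   | yes _ | yes _ = contradiction φu≡φv (y-≢ u≢v)
    -- `X` and `Y` are disjoint because `cross` includes distinctness.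
    ...   | yes _ | no  _ = contradiction (sym φu≡φv) (proj₁ (xy-adj v u))
    ...   | no  _ | yes _ = contradiction φu≡φv (proj₁ (xy-adj u v))
    ...   | no  _ | no  _ = contradiction φu≡φv (proj₁ (x-adj u≢v))

    split⇒balanced : 2 * degreeSum G I ≡ length (edges G) → ContainsBalancedCopy α G
    split⇒balanced half = balanced-copy G independent half α φ-injective c touching avoiding
      where
      touching : ∀ {u v} → u ∼ v → u ∈ˢ I ⊎ v ∈ˢ I → colour (φ u) (φ v) ≡ c
      touching {u} {v} u∼v uv∈I with u ∈? I | v ∈? I
      -- The colours inside `Y` are unknown, but independence excludes an edge there.
      ... | yes u∈I | yes v∈I = contradiction u∼v (independent u∈I v∈I)
      ... | yes _   | no  _   = proj₂ (Adj-sym (xy-adj v u))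
      ... | no  _   | yes _   = proj₂ (xy-adj u v)
      touching u∼v (inj₁ u∈I) | no u∉I | no _   = contradiction u∈I u∉I
      touching u∼v (inj₂ v∈I) | no _   | no v∉I = contradiction v∈I v∉I

      avoiding : ∀ {u v} → u ∼ v → u ∉ˢ I → v ∉ˢ I → colour (φ u) (φ v) ≡ opp c
      avoiding {u} {v} u∼v u∉I v∉I with u ∈? I | v ∈? I
      ... | yes u∈I | _       = contradiction u∈I u∉I
      ... | no  _   | yes v∈I = contradiction v∈I v∉I
      ... | no  _   | no  _   = proj₂ (x-adj (λ u≡v → irreflexive u≡v u∼v))

  Split-mono : ∀ {c s t} → s ≤ t → Split c t → Split c s
  Split-mono s≤t split = record
    { X = X ; Y = Y ; X-clique = X-clique ; Y! = Y! ; cross = cross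
    ; X-length = ≤-trans s≤t X-length ; Y-length = ≤-trans s≤t Y-length }
    where open Split split

-- Sizes of the colour classes and the theorem.

2*nC2+n≡n² : ∀ n → 2 * (n C 2) + n ≡ n * n
2*nC2+n≡n² zero    = refl
2*nC2+n≡n² (suc n) = begin
  2 * (suc n C 2) + suc n       ≡⟨ cong (λ m → 2 * m + suc n) (nCk+nC[k+1]≡[n+1]C[k+1] n 1) ⟨
  2 * (n C 1 + n C 2) + suc n   ≡⟨ cong (λ m → 2 * (m + n C 2) + suc n) (nC1≡n n) ⟩
  2 * (n + n C 2) + suc n       ≡⟨ regroup n (n C 2) ⟩
  2 * (n C 2) + n + (2 * n + 1) ≡⟨ cong (_+ (2 * n + 1)) (2*nC2+n≡n² n) ⟩
  n * n + (2 * n + 1)           ≡⟨ square n ⟩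
  suc n * suc n                 ∎
  where
  open ≡-Reasoning
  regroup : ∀ n c → 2 * (n + c) + suc n ≡ 2 * c + n + (2 * n + 1)
  regroup = solve-∀
  square : ∀ n → n * n + (2 * n + 1) ≡ suc n * suc n
  square = solve-∀

-- Rounding down loses a remainder of at most 1, which `2*nC2+n≡n²` doubles; this is the constant 2.
half-dense : ∀ n s → (n C 2) / 2 ≤ s → n * n ≤ 4 * s + n + 2
half-dense n s h≤s = begin
  n * n           ≡⟨ 2*nC2+n≡n² n ⟨
  2 * (n C 2) + n ≡⟨ cong (λ m → 2 * m + n) (m≡m%n+[m/n]*n (n C 2) 2) ⟩
  2 * ((n C 2) % 2 + (n C 2) / 2 * 2) + n
    ≤⟨ +-monoˡ-≤ n (*-monoʳ-≤ 2 (+-mono-≤ (s≤s⁻¹ (m%n<n (n C 2) 2)) (*-monoˡ-≤ 2 h≤s))) ⟩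
  2 * (1 + s * 2) + n ≡⟨ regroup s n ⟩
  4 * s + n + 2       ∎
  where
  open ≤-Reasoning
  regroup : ∀ s n → 2 * (1 + s * 2) + n ≡ 4 * s + n + 2
  regroup = solve-∀

0<nC2/2 : ∀ n → 3 ≤ n → 0 < (n C 2) / 2
0<nC2/2 (suc n) (s≤s 2≤n) = /-monoˡ-≤ 2 (begin
  2             ≤⟨ 2≤n ⟩
  n             ≡⟨ nC1≡n n ⟨
  n C 1         ≤⟨ m≤m+n (n C 1) (n C 2) ⟩
  n C 1 + n C 2 ≡⟨ nCk+nC[k+1]≡[n+1]C[k+1] n 1 ⟩
  suc n C 2     ∎)
  where open ≤-Reasoning

proposition3 : ∀ {k : ℕ} (G : Graph k) →
    (∃[ I ] (Independent G I × 2 * degreeSum G I ≡ length (edges G))) →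
    Balanceable G
-- The 3 makes the floor positive. `n₀ k` yields a split of size `suc k`, cut down to `k` below, so
-- that `k = 0` needs no separate case.
proposition3 {k} G (I , independent , half) = 3 + n₀ k , λ n n≥ →
  -- With this choice, more than `m` edges means at least `(n C 2) / 2` edges.
  pred ((n C 2) / 2) , pred< (0<nC2/2 n (m+n≤o⇒m≤o 3 n≥)) , λ α R> B> →
    let dense : ∀ c → n * n ≤ 4 * classSize α c + n + 2
        dense = λ { R → half-dense n _ (pred<⇒≤ R>) ; B → half-dense n _ (pred<⇒≤ B>) }
        (c , split) = unavoidable-split α k (m+n≤o⇒n≤o 3 n≥) dense
    in split⇒balanced α G independent (Split-mono α (n≤1+n k) split) half
  where
  pred< : ∀ {m} → 0 < m → pred m < m
  pred< {suc m} _ = ≤-refl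
  pred<⇒≤ : ∀ {m s} → pred m < s → m ≤ s
  pred<⇒≤ {zero}  _ = z≤n
  pred<⇒≤ {suc m} p = p
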